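{- There exists a $3$-connected cubic planar graph, of order $420$, that contains no cycle of length $4$, no cycle of length $8$, and no cycle of length $16$.
   Context: Graphs are finite and simple (no loops or multiple edges). A graph is cubic if every vertex has degree $3$; the order of a graph is its number of vertices. A cycle of length $n$ is a subgraph isomorphic to the $n$-cycle (not necessarily induced). A graph is $3$-connected if it has more than $3$ vertices and remains connected after the removal of any set of fewer than $3$ vertices. -}

module Defs where

open import Data.Fin.Base using (Fin; zero; suc; toℕ; fromℕ; inject₁)
import Data.Fin.Base as Fin
open import Data.Fin.Subset using (Subset; _∉_; ∣_∣)
open import Data.Integer.Base using (+_)
open import Data.List.Base using (length; filter; allFin)
open import Data.Nat.Base using (ℕ; suc; _≤_; _<_; _%_; NonZero)
open import Data.Product.Base using (∃-syntax; _×_; _,_)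
open import Data.Rational.Base as ℚ using (ℚ; 0ℚ; 1ℚ; _/_)
open import Function.Definitions using (Injective)
open import Level using (0ℓ)
open import Relation.Binary.Construct.Closure.ReflexiveTransitive using (Star)
open import Relation.Binary.Core using (Rel)
open import Relation.Binary.Definitions using (Symmetric; Irreflexive; Decidable)
open import Relation.Binary.PropositionalEquality.Core using (_≡_; _≢_)
open import Relation.Nullary.Negation.Core using (¬_)

record Graph (n : ℕ) : Set₁ where
  infix 4 _~_ _~?_
  field
    _~_    : Rel (Fin n) 0ℓ
    _~?_   : Decidable _~_
    sym    : Symmetric _~_
    irrefl : Irreflexive _≡_ _~_

module _ {n : ℕ} (G : Graph n) where
  open Graph G

  degree : Fin n → ℕ
  degree v = length (filter (v ~?_) (allFin n))

  Cubic : Set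
  Cubic = ∀ v → degree v ≡ 3

  -- A subgraph isomorphic to the k-cycle is the image of an injective
  -- homomorphism from the k-cycle, whose vertices are the residues modulo k.
  record Cycle (k : ℕ) .{{_ : NonZero k}} : Set where
    field
      3≤k      : 3 ≤ k
      vertex   : Fin k → Fin n
      distinct : Injective _≡_ _≡_ vertex
      adjacent : ∀ i j → toℕ j ≡ suc (toℕ i) % k → vertex i ~ vertex j

  -- "Outside S" refers to the graph G − S.
  AdjOutside : Subset n → Rel (Fin n) 0ℓ
  AdjOutside S u v = u ∉ S × v ∉ S × u ~ v

  ConnectedOutside : Subset n → Set
  ConnectedOutside S = ∀ u v → u ∉ S → v ∉ S → Star (AdjOutside S) u v

  KConnected : ℕ → Set
  KConnected k = k < n × (∀ (S : Subset n) → ∣ S ∣ < k → ConnectedOutside S)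

  -- Each undirected edge is listed once, from its smaller end to its larger.
  record Edge : Set where
    field
      src tgt : Fin n
      src<tgt : src Fin.< tgt
      adj     : src ~ tgt

-- Plane drawings, with edges drawn as polygonal arcs.  The plane is ℚ² in the
-- absence of real numbers.  This does not affect planarity: segments with
-- rational ends that have a common point have a rational one, so a drawing in
-- ℚ² is also one in ℝ²; and a polygonal drawing in ℝ² can be perturbed to one
-- whose corners are rational.

Point : Set
Point = ℚ × ℚ

-- The point (1 − t) p + t q.
between : Point → Point → ℚ → Point
between (x₁ , y₁) (x₂ , y₂) t = mix x₁ x₂ , mix y₁ y₂
  where
  mix : ℚ → ℚ → ℚ
  mix a b = (1ℚ ℚ.- t) ℚ.* a ℚ.+ t ℚ.* b

record InUnit (t : ℚ) : Set where
  field
    lower : 0ℚ ℚ.≤ t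
    upper : t ℚ.≤ 1ℚ

-- An injective piecewise linear path with m + 1 segments, segment i being
-- traversed during the parameter interval [i , i + 1].
record Arc : Set where
  field
    m      : ℕ
    corner : Fin (suc (suc m)) → Point

  at : Fin (suc m) → ℚ → Point
  at i = between (corner (inject₁ i)) (corner (suc i))

  time : Fin (suc m) → ℚ → ℚ
  time i t = + toℕ i / 1 ℚ.+ t

  field
    injective : ∀ i j s t → InUnit s → InUnit t →
                at i s ≡ at j t → time i s ≡ time j t

  start end : Point
  start = corner zero
  end   = corner (fromℕ (suc m))

infix 4 _on_ _inside_

_on_ : Point → Arc → Set
p on A = ∃[ i ] ∃[ t ] (InUnit t × p ≡ Arc.at A i t)

_inside_ : Point → Arc → Set
p inside A = p on A × p ≢ Arc.start A × p ≢ Arc.end A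

record Planar {n : ℕ} (G : Graph n) : Set where
  open Edge
  field
    pos           : Fin n → Point
    pos-injective : Injective _≡_ _≡_ pos
    arc           : Edge G → Arc
    arc-start     : ∀ e → Arc.start (arc e) ≡ pos (src e)
    arc-end       : ∀ e → Arc.end (arc e) ≡ pos (tgt e)
    avoids-vertex : ∀ e w → ¬ (pos w inside arc e)
    avoids-edge   : ∀ e f → ¬ (src e ≡ src f × tgt e ≡ tgt f) →
                    ∀ p → p inside arc e → ¬ (p on arc f)

{-# OPTIONS --safe #-}

-- A Schnyder wood with its barycentric coordinates serves twice.  Every vertex
-- outside the root triangle has a parent in each of three trees; passing to the
-- parent in tree i raises coordinate i and raises no other coordinate.  Hence the
-- three tree paths from a vertex to the triangle meet only in that vertex, and
-- two deleted vertices cannot block all three.  The coordinates also give a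
-- straight-line drawing, in which any two edges are separated by a line from a
-- few fixed directions.  Cycles of a given length are excluded by a search that
-- visits each cycle from its least vertex.
module Submission where

open import Data.Nat.Base using (nonZero)
open import Data.Product.Base using (Σ-syntax; _×_)
open import Relation.Nullary.Negation.Core using (¬_)
open import Defs

import Algebra.Properties.Group as GroupProperties
open import Data.Bool.Base using (Bool; true; false; T; not; _∧_; _∨_)
open import Data.Bool.ListAction using (all; any)
open import Data.Bool.Properties using (T-≡; T-∧; T-∨)
open import Data.Empty using (⊥-elim)
open import Data.Fin.Base as Fin using (Fin; zero; suc; toℕ; fromℕ<)
open import Data.Fin.Patterns using (0F; 1F; 2F)
import Data.Fin.Properties as Fin
open import Data.Fin.Subset using (Subset; ∣_∣; _-_) renaming (_∈_ to _∈ₛ_; _∉_ to _∉ₛ_)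
open import Data.Fin.Subset.Properties using (x∈p⇒∣p-x∣<∣p∣; x∈p∧x≢y⇒x∈p-y) renaming (_∈?_ to _∈ₛ?_)
open import Data.Integer.Base as ℤ using (+_)
import Data.Integer.Properties as ℤ
open import Data.List.Base as List using (List; []; _∷_)
open import Data.List.Membership.Propositional using (lose) renaming (_∈_ to _∈ₗ_)
open import Data.List.Membership.Propositional.Properties
  using (∈-filter⁺; ∈-filter⁻; ∈-map⁺; ∈-concatMap⁺; ∈-upTo⁺; ∈-tabulate⁺; ∈-tabulate⁻; ∈-allFin)
open import Data.List.Membership.Propositional.Properties.WithK using (unique∧set⇒bag)
open import Data.List.Properties using (length-tabulate)
open import Data.List.Relation.Binary.BagAndSetEquality using (∼bag⇒↭)
open import Data.List.Relation.Binary.Permutation.Propositional.Properties using (↭-length)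
open import Data.List.Relation.Unary.All as ListAll using ([]; _∷_)
open import Data.List.Relation.Unary.All.Properties using (all⁺; all⁻)
open import Data.List.Relation.Unary.Any.Properties using (any⁺)
import Data.List.Relation.Unary.Unique.Propositional.Properties as Unique
open import Data.Nat.Base as ℕ using (ℕ; zero; suc; _≤_; _<_; _≤ᵇ_; _<ᵇ_; _≡ᵇ_; _+_; _*_; _∸_; _⊓_; _⊔_; _/_; _%_; z≤n; s≤s; NonZero)
open import Data.Nat.DivMod using (m%n<n; m%n%n≡m%n; %-distribˡ-+; [m+n]%n≡m%n; m<n⇒m%n≡m)
import Data.Nat.Properties as ℕ
open import Data.Product.Base using (∃-syntax; _,_; proj₁; proj₂; curry)
open import Data.Rational.Base as ℚ using (ℚ; 0ℚ; 1ℚ)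
open import Data.Rational.Literals using (fromℤ)
import Data.Rational.Properties as ℚ
open import Data.Rational.Solver using (module +-*-Solver)
import Data.Rational.Unnormalised.Base as ℚᵘ
import Data.Rational.Unnormalised.Properties as ℚᵘ
open import Data.Sum.Base as Sum using (_⊎_; inj₁; inj₂)
open import Data.Vec.Base as Vec using (Vec; []; _∷_; lookup; toList)
open import Data.Vec.Membership.DecPropositional ℕ._≟_ using (_∈?_)
open import Data.Vec.Membership.Propositional using (_∈_; _∉_)
open import Data.Vec.Membership.Propositional.Properties using (∈-lookup; ∈-toList⁺)
open import Data.Vec.Relation.Unary.All as All using (All; []; _∷_)
open import Data.Vec.Relation.Unary.Any using (index)
open import Data.Vec.Relation.Unary.Any.Properties using (lookup-index)
open import Function.Base using (_∘_; _$_)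
open import Function.Bundles using (Equivalence; mk⇔)
open import Function.Definitions using (Injective)
open import Relation.Binary.Construct.Closure.ReflexiveTransitive using (Star; ε; _◅_; _◅◅_; reverse)
open import Relation.Binary.Definitions using (tri<; tri≈; tri>)
open import Relation.Binary.PropositionalEquality
  using (_≡_; _≢_; refl; sym; trans; cong; cong₂; subst; module ≡-Reasoning)
open import Relation.Nullary.Decidable
  using (Dec; yes; no; ⌊_⌋; toWitness; ¬?; _×-dec_; _→-dec_)

open +-*-Solver using (solve; con; _:+_; _:*_; _:-_; _:=_)

-- Three-connectedness

-- A vertex of a cubic graph has just three neighbours, so these are its three parents, and a single
-- table gives both the adjacency and the Schnyder wood. An edge with no end in the root triangle
-- therefore belongs to two different trees, once in each direction; the coordinate of the remaining
-- tree can rise in neither direction and is constant along the edge. So the edge is parallel to a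
-- side of the triangle. This is why a few directions suffice for the drawing. Two segments that are
-- not collinear and meet at most in a common end are separated by a line parallel to one of them.
-- All edges are level lines of a coordinate, apart from the three that enter the corners of the
-- triangle from inside, along each of which two coordinates agree. The numerical conditions are
-- thus inequalities between natural numbers, decided by evaluation; rational arithmetic is confined
-- to lemmas about arbitrary coordinates.

three≤∣S∣ : ∀ {n} {S : Subset n} {a b c} → a ∈ₛ S → b ∈ₛ S → c ∈ₛ S → a ≢ b → a ≢ c → b ≢ c → 3 ≤ ∣ S ∣
three≤∣S∣ {S = S} {a} {b} {c} a∈S b∈S c∈S a≢b a≢c b≢c = begin-strict
  2                  ≤⟨ s≤s (ℕ.≤-<-trans z≤n (x∈p⇒∣p-x∣<∣p∣ c∈S-a-b)) ⟩
  suc ∣ S - a - b ∣  ≤⟨ x∈p⇒∣p-x∣<∣p∣ b∈S-a ⟩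
  ∣ S - a ∣          <⟨ x∈p⇒∣p-x∣<∣p∣ a∈S ⟩
  ∣ S ∣              ∎
  where
  open ℕ.≤-Reasoning
  b∈S-a : b ∈ₛ S - a
  b∈S-a = x∈p∧x≢y⇒x∈p-y b∈S (a≢b ∘ sym)
  c∈S-a-b : c ∈ₛ S - a - b
  c∈S-a-b = x∈p∧x≢y⇒x∈p-y (x∈p∧x≢y⇒x∈p-y c∈S (a≢c ∘ sym)) (b≢c ∘ sym)

module SchnyderWood {n : ℕ} (G : Graph n)
  (parent : Fin 3 → Fin n → Fin n) (coord : Fin 3 → Fin n → ℕ) (root : Fin 3 → Fin n) (C : ℕ)
  (~-parent : ∀ i v → Graph._~_ G v (parent i v))
  (bounded : ∀ i v → coord i v ≤ C)
  (rising : ∀ i v → (∀ r → v ≢ root r) → coord i v < coord i (parent i v))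
  (falling : ∀ i j v → (∀ r → v ≢ root r) → i ≢ j → coord j (parent i v) ≤ coord j v)
  (roots-adjacent : ∀ r s → r ≢ s → Graph._~_ G (root r) (root s))
  where

  module _ (S : Subset n) (∣S∣<3 : ∣ S ∣ < 3) where

    Linked : Fin n → Fin n → Set
    Linked = Star (AdjOutside G S)

    Escapes : Fin n → Set
    Escapes v = ∃[ r ] (root r ∉ₛ S × Linked v (root r))

    -- The path to the blocking vertex is forgotten. The inequalities that remain are transitive
    -- along a tree path and tell the three trees apart.
    Blocked : Fin 3 → Fin n → Set
    Blocked i v = ∃[ w ] (w ∈ₛ S × coord i v < coord i w × (∀ j → i ≢ j → coord j w ≤ coord j v))

    -- Coordinate `i` rises at every step and never exceeds `C`, so a root or a deleted vertex is
    -- met before the fuel runs out. Any root ends the walk, whichever tree is followed.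
    trace : ∀ fuel i v → C < fuel + coord i v → v ∉ₛ S → Escapes v ⊎ Blocked i v
    trace zero i v C<v v∉S = ⊥-elim (ℕ.<-irrefl refl (ℕ.<-≤-trans C<v (bounded i v)))
    trace (suc fuel) i v C<v v∉S with Fin.any? (λ r → v Fin.≟ root r)
    ... | yes (r , refl) = inj₁ (r , v∉S , ε)
    ... | no ¬root with parent i v ∈ₛ? S
    ...   | yes p∈S = inj₂ (parent i v , p∈S , rising i v (curry ¬root) , λ j → falling i j v (curry ¬root))
    ...   | no p∉S = Sum.map
        (λ (r , r∉S , p⇝r) → r , r∉S , (v∉S , p∉S , ~-parent i v) ◅ p⇝r)
        (λ (w , w∈S , p<w , w≤p) → w , w∈S , ℕ.<-trans v<p p<w ,
           λ j i≢j → ℕ.≤-trans (w≤p j i≢j) (falling i j v (curry ¬root) i≢j))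
        (trace fuel i (parent i v) C<p p∉S)
      where
      v<p : coord i v < coord i (parent i v)
      v<p = rising i v (curry ¬root)
      C<p : C < fuel + coord i (parent i v)
      C<p = ℕ.<-≤-trans C<v (ℕ.≤-trans (ℕ.≤-reflexive (sym (ℕ.+-suc fuel _))) (ℕ.+-monoʳ-≤ fuel v<p))

    -- A vertex that blocks tree `i` exceeds `v` in coordinate `i`; one that blocks another tree
    -- does not.
    blocks-differ : ∀ {i j v} → i ≢ j → ((w , _) : Blocked i v) ((w′ , _) : Blocked j v) → w ≢ w′
    blocks-differ i≢j (_ , _ , v<w , _) (_ , _ , _ , w≤v) refl =
      ℕ.<⇒≱ v<w (w≤v _ (i≢j ∘ sym))

    escapes : ∀ v → v ∉ₛ S → Escapes v
    escapes v v∉S with along 0F | along 1F | along 2F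
      where
      along : ∀ i → Escapes v ⊎ Blocked i v
      along i = trace (suc C) i v (s≤s (ℕ.m≤m+n C _)) v∉S
    ... | inj₁ e | _ | _ = e
    ... | _ | inj₁ e | _ = e
    ... | _ | _ | inj₁ e = e
    ... | inj₂ a | inj₂ b | inj₂ c = ⊥-elim $ ℕ.<⇒≱ ∣S∣<3 $
      three≤∣S∣ (proj₁ (proj₂ a)) (proj₁ (proj₂ b)) (proj₁ (proj₂ c))
        (blocks-differ (λ ()) a b) (blocks-differ (λ ()) a c) (blocks-differ (λ ()) b c)

    linked-sym : ∀ {u v} → Linked u v → Linked v u
    linked-sym = reverse λ (u∉S , v∉S , u~v) → v∉S , u∉S , Graph.sym G u~v

    -- Both vertices reach roots outside `S`, and these roots coincide or are adjacent.
    connected : ConnectedOutside G S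
    connected u v u∉S v∉S with escapes u u∉S | escapes v v∉S
    ... | r , r∉S , u⇝r | s , s∉S , v⇝s with r Fin.≟ s
    ...   | yes refl = u⇝r ◅◅ linked-sym v⇝s
    ...   | no r≢s = u⇝r ◅◅ (r∉S , s∉S , roots-adjacent r s r≢s) ◅ linked-sym v⇝s

  3-connected : 3 < n → KConnected G 3
  3-connected 3<n = 3<n , connected

-- Cycles

suc-% : ∀ m k .{{_ : NonZero k}} → suc (m % k) % k ≡ suc m % k
suc-% m k = begin
  suc (m % k) % k              ≡⟨ %-distribˡ-+ 1 (m % k) k ⟩
  (1 % k + m % k % k) % k      ≡⟨ cong (λ r → (1 % k + r) % k) (m%n%n≡m%n m k) ⟩
  (1 % k + m % k) % k          ≡⟨ %-distribˡ-+ 1 m k ⟨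
  suc m % k                    ∎
  where open ≡-Reasoning

-- Adding `k ∸ m` undoes the shift by `m` modulo `k`.
%-cancelˡ : ∀ m {k a b} .{{_ : NonZero k}} → m ≤ k → a < k → b < k → (m + a) % k ≡ (m + b) % k → a ≡ b
%-cancelˡ m {k} {a} {b} m≤k a<k b<k eq = trans (sym (shift a<k)) (trans (cong (λ r → ((k ∸ m) % k + r) % k) eq) (shift b<k))
  where
  open ≡-Reasoning
  shift : ∀ {c} → c < k → ((k ∸ m) % k + (m + c) % k) % k ≡ c
  shift {c} c<k = begin
    ((k ∸ m) % k + (m + c) % k) % k ≡⟨ %-distribˡ-+ (k ∸ m) (m + c) k ⟨
    (k ∸ m + (m + c)) % k           ≡⟨ cong (_% k) (ℕ.+-assoc (k ∸ m) m c) ⟨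
    (k ∸ m + m + c) % k             ≡⟨ cong (λ r → (r + c) % k) (ℕ.m∸n+n≡m m≤k) ⟩
    (k + c) % k                     ≡⟨ cong (_% k) (ℕ.+-comm k c) ⟩
    (c + k) % k                     ≡⟨ [m+n]%n≡m%n c k ⟩
    c % k                           ≡⟨ m<n⇒m%n≡m c<k ⟩
    c                               ∎

argmin : ∀ {k} (f : Fin (suc k) → ℕ) → ∃[ i ] (∀ j → f i ≤ f j)
argmin {zero} f = zero , λ { zero → ℕ.≤-refl }
argmin {suc k} f with argmin (f ∘ suc)
... | i , least with ℕ.≤-total (f zero) (f (suc i))
...   | inj₁ f0≤ = zero , λ { zero → ℕ.≤-refl ; (suc j) → ℕ.≤-trans f0≤ (least j) }
...   | inj₂ ≤f0 = suc i , λ { zero → ≤f0 ; (suc j) → least j }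

¬⇒T-not : ∀ {b} → ¬ T b → T (not b)
¬⇒T-not {false} _ = _
¬⇒T-not {true} ¬b = ⊥-elim (¬b _)

T-not⇒¬ : ∀ {b} → T (not b) → ¬ T b
T-not⇒¬ {false} _ ()

module Search (nbrs : ℕ → Vec ℕ 3) where

  -- Whether a path that has reached v can be extended, by k vertices above s
  -- outside visited, to one that ends next to s.
  closes : ℕ → ℕ → List ℕ → ℕ → Bool
  step   : ℕ → ℕ → List ℕ → ℕ → Bool

  closes s zero    visited v = any (_≡ᵇ s) (toList (nbrs v))
  closes s (suc k) visited v = any (step s k visited) (toList (nbrs v))

  -- The test `s <ᵇ w` also keeps the path from coming back to `s` too early, which is why `visited`
  -- can start empty.
  step s k visited w = (s <ᵇ w) ∧ all (λ x → not (w ≡ᵇ x)) visited ∧ closes s k (w ∷ visited) w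

  module _ {k : ℕ} (c : ℕ → ℕ)
    (adjacent : ∀ j → c (suc j) ∈ nbrs (c j))
    (distinct : ∀ {i j} → i ≤ k → j ≤ k → c i ≡ c j → i ≡ j)
    (least : ∀ j → c 0 ≤ c j)
    (closed : c (suc k) ≡ c 0)
    where

    -- The cycle itself witnesses every `any` of the search: after `j` steps the search stands at
    -- `c j` with `l` vertices to come. Since `visited` holds only terms of index at most `j`,
    -- distinctness makes `c (suc j)` new; it also turns the minimality of `c 0` into a strict
    -- inequality.
    closes-cycle : ∀ l j visited → l + j ≡ k → ListAll.All (λ w → ∃[ i ] (i ≤ j × w ≡ c i)) visited →
                   T (closes (c 0) l visited (c j))
    closes-cycle zero j visited refl _ =
      any⁺ _ (lose (∈-toList⁺ (subst (_∈ nbrs (c j)) closed (adjacent j))) (ℕ.≡⇒≡ᵇ (c 0) _ refl))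
    closes-cycle (suc l) j visited eq seen = any⁺ (step (c 0) l visited) $ lose (∈-toList⁺ (adjacent j)) $
      Equivalence.from T-∧
        ( ℕ.<⇒<ᵇ (ℕ.≤∧≢⇒< (least (suc j)) (ℕ.0≢1+n ∘ distinct z≤n j<k))
        , Equivalence.from T-∧
            ( all⁻ _ (ListAll.map fresh seen)
            , closes-cycle l (suc j) _ (trans (ℕ.+-suc l j) eq)
                ((suc j , ℕ.≤-refl , refl) ∷ ListAll.map (λ (i , i≤j , w≡) → i , ℕ.m≤n⇒m≤1+n i≤j , w≡) seen)))
      where
      j<k : j < k
      j<k = subst (j <_) eq (s≤s (ℕ.m≤n+m j l))
      fresh : ∀ {w} → ∃[ i ] (i ≤ j × w ≡ c i) → T (not (c (suc j) ≡ᵇ w))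
      fresh (i , i≤j , refl) = ¬⇒T-not λ eq →
        ℕ.<⇒≢ (s≤s i≤j) (distinct (ℕ.≤-trans i≤j (ℕ.<⇒≤ j<k)) j<k (sym (ℕ.≡ᵇ⇒≡ _ _ eq)))

  module _ {n : ℕ} (G : Graph n) (~⇒∈ : ∀ {u v} → Graph._~_ G u v → toℕ v ∈ nbrs (toℕ u)) where

    -- The cycle is unrolled into a periodic sequence that starts at its least vertex, where the
    -- search would find it. The start is not counted by `k`, so the length is `suc k`.
    no-cycle : ∀ k → (∀ {s} → s < n → T (not (closes s k [] s))) → ¬ Cycle G (suc k)
    no-cycle k none C = T-not⇒¬ (none (Fin.toℕ<n (vertex (at 0))))
      (closes-cycle c adjacent′ distinct′ (λ j → least (at j)) closed k 0 [] (ℕ.+-identityʳ k) [])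
      where
      open Cycle C
      i₀ : Fin (suc k)
      i₀ = proj₁ (argmin (toℕ ∘ vertex))
      m = toℕ i₀
      at : ℕ → Fin (suc k)
      at j = fromℕ< (m%n<n (m + j) (suc k))
      c : ℕ → ℕ
      c = toℕ ∘ vertex ∘ at
      toℕ-at : ∀ j → toℕ (at j) ≡ (m + j) % suc k
      toℕ-at j = Fin.toℕ-fromℕ< (m%n<n (m + j) (suc k))
      at-0 : at 0 ≡ i₀
      at-0 = Fin.toℕ-injective (trans (toℕ-at 0) (trans (cong (_% suc k) (ℕ.+-identityʳ m)) (m<n⇒m%n≡m (Fin.toℕ<n i₀))))
      least : ∀ i → c 0 ≤ toℕ (vertex i)
      least i = subst (λ i₀ → toℕ (vertex i₀) ≤ _) (sym at-0) (proj₂ (argmin (toℕ ∘ vertex)) i)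
      adjacent′ : ∀ j → c (suc j) ∈ nbrs (c j)
      adjacent′ j = ~⇒∈ (adjacent (at j) (at (suc j)) (begin
        toℕ (at (suc j))            ≡⟨ toℕ-at (suc j) ⟩
        (m + suc j) % suc k         ≡⟨ cong (_% suc k) (ℕ.+-suc m j) ⟩
        suc (m + j) % suc k         ≡⟨ suc-% (m + j) (suc k) ⟨
        suc ((m + j) % suc k) % suc k ≡⟨ cong (λ r → suc r % suc k) (toℕ-at j) ⟨
        suc (toℕ (at j)) % suc k    ∎))
        where open ≡-Reasoning
      distinct′ : ∀ {i j} → i ≤ k → j ≤ k → c i ≡ c j → i ≡ j
      distinct′ {i} {j} i≤k j≤k eq = %-cancelˡ m (ℕ.<⇒≤ (Fin.toℕ<n i₀)) (s≤s i≤k) (s≤s j≤k)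
        (trans (sym (toℕ-at i)) (trans (cong toℕ (distinct (Fin.toℕ-injective eq))) (toℕ-at j)))
      closed : c (suc k) ≡ c 0
      closed = cong (toℕ ∘ vertex) (Fin.toℕ-injective (begin
        toℕ (at (suc k))      ≡⟨ toℕ-at (suc k) ⟩
        (m + suc k) % suc k   ≡⟨ [m+n]%n≡m%n m (suc k) ⟩
        m % suc k             ≡⟨ cong (_% suc k) (ℕ.+-identityʳ m) ⟨
        (m + 0) % suc k       ≡⟨ toℕ-at 0 ⟨
        toℕ (at 0)            ∎))
        where open ≡-Reasoning

-- Straight-line drawings

value : Vec ℕ 3 → Vec ℕ 3 → ℕ
value (a ∷ b ∷ c ∷ []) (x ∷ y ∷ z ∷ []) = a * x + b * y + c * z

extent : Vec ℕ 3 → Vec ℕ 3 → Vec ℕ 3 → ℕ × ℕ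
extent p q w = value w p ⊓ value w q , value w p ⊔ value w q

infix 4 _≺_

-- One inequality is weak, so that segments with a common end are covered.
_≺_ : ℕ × ℕ → ℕ × ℕ → Set
(l , h) ≺ (l′ , h′) = h ≤ l′ × l < l′

-- With `fromℤ` the denominator is 1 by definition, so injectivity and monotonicity can be read off
-- the numerators.
ι : ℕ → ℚ
ι k = fromℤ (+ k)

ι-+ : ∀ j k → ι (j + k) ≡ ι j ℚ.+ ι k
ι-+ j k = ℚ.toℚᵘ-injective $ ℚᵘ.≃-trans
  (ℚᵘ.*≡* (cong (ℤ._* + 1) (sym (cong₂ ℤ._+_ (ℤ.*-identityʳ (+ j)) (ℤ.*-identityʳ (+ k))))))
  (ℚᵘ.≃-sym (ℚ.toℚᵘ-homo-+ (ι j) (ι k)))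

ι-* : ∀ j k → ι (j * k) ≡ ι j ℚ.* ι k
ι-* j k = ℚ.toℚᵘ-injective $ ℚᵘ.≃-trans
  (ℚᵘ.*≡* (cong (ℤ._* + 1) (ℤ.pos-* j k)))
  (ℚᵘ.≃-sym (ℚ.toℚᵘ-homo-* (ι j) (ι k)))

ι-injective : ∀ {j k} → ι j ≡ ι k → j ≡ k
ι-injective = ℤ.+-injective ∘ cong ℚ.numerator

ι-mono-≤ : ∀ {j k} → j ≤ k → ι j ℚ.≤ ι k
ι-mono-≤ = ℚ.*≤* ∘ ℤ.*-monoʳ-≤-nonNeg (+ 1) ∘ ℤ.+≤+

ι-mono-< : ∀ {j k} → j < k → ι j ℚ.< ι k
ι-mono-< = ℚ.*<* ∘ ℤ.*-monoʳ-<-pos (+ 1) ∘ ℤ.+<+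

-- Agrees by definition with each coordinate of `between`.
mix : ℚ → ℚ → ℚ → ℚ
mix t a b = (1ℚ ℚ.- t) ℚ.* a ℚ.+ t ℚ.* b

mix-idem : ∀ t a → mix t a a ≡ a
mix-idem = solve 2 (λ t a → (con 1ℚ :- t) :* a :+ t :* a := a) refl

mix-0 : ∀ a b → mix 0ℚ a b ≡ a
mix-0 = solve 2 (λ a b → (con 1ℚ :- con 0ℚ) :* a :+ con 0ℚ :* b := a) refl

mix-1 : ∀ a b → mix 1ℚ a b ≡ b
mix-1 = solve 2 (λ a b → (con 1ℚ :- con 1ℚ) :* a :+ con 1ℚ :* b := b) refl

0≤1-t : ∀ {t} → t ℚ.≤ 1ℚ → 0ℚ ℚ.≤ 1ℚ ℚ.- t
0≤1-t {t} t≤1 = subst (ℚ._≤ 1ℚ ℚ.- t) (ℚ.+-inverseʳ t) (ℚ.+-monoˡ-≤ (ℚ.- t) t≤1)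

0<1-t : ∀ {t} → t ℚ.< 1ℚ → 0ℚ ℚ.< 1ℚ ℚ.- t
0<1-t {t} t<1 = subst (ℚ._< 1ℚ ℚ.- t) (ℚ.+-inverseʳ t) (ℚ.+-monoˡ-< (ℚ.- t) t<1)

mix-mono-≤ : ∀ {t a b c d} → InUnit t → a ℚ.≤ c → b ℚ.≤ d → mix t a b ℚ.≤ mix t c d
mix-mono-≤ {t} u a≤c b≤d = ℚ.+-mono-≤
  (ℚ.*-monoˡ-≤-nonNeg (1ℚ ℚ.- t) {{ℚ.nonNegative (0≤1-t (InUnit.upper u))}} a≤c)
  (ℚ.*-monoˡ-≤-nonNeg t {{ℚ.nonNegative (InUnit.lower u)}} b≤d)

≤-mix : ∀ {t a b m} → InUnit t → m ℚ.≤ a → m ℚ.≤ b → m ℚ.≤ mix t a b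
≤-mix {t} {m = m} u m≤a m≤b = subst (ℚ._≤ _) (mix-idem t m) (mix-mono-≤ u m≤a m≤b)

-- Away from the ends both weights `1ℚ - t` and `t` are positive, so strictness at either end is
-- inherited by the mixture.
mix-< : ∀ {t a b m} → 0ℚ ℚ.< t → t ℚ.< 1ℚ → a ℚ.≤ m → b ℚ.≤ m → a ℚ.< m ⊎ b ℚ.< m → mix t a b ℚ.< m
mix-< {t} {m = m} 0<t t<1 a≤m b≤m (inj₁ a<m) = subst (_ ℚ.<_) (mix-idem t m) $ ℚ.+-mono-<-≤
  (ℚ.*-monoʳ-<-pos (1ℚ ℚ.- t) {{ℚ.positive (0<1-t t<1)}} a<m)
  (ℚ.*-monoˡ-≤-nonNeg t {{ℚ.nonNegative (ℚ.<⇒≤ 0<t)}} b≤m)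
mix-< {t} {m = m} 0<t t<1 a≤m b≤m (inj₂ b<m) = subst (_ ℚ.<_) (mix-idem t m) $ ℚ.+-mono-≤-<
  (ℚ.*-monoˡ-≤-nonNeg (1ℚ ℚ.- t) {{ℚ.nonNegative (0≤1-t (ℚ.<⇒≤ t<1))}} a≤m)
  (ℚ.*-monoʳ-<-pos t {{ℚ.positive 0<t}} b<m)

≤∧≢⇒<ℚ : ∀ {p q} → p ℚ.≤ q → p ≢ q → p ℚ.< q
≤∧≢⇒<ℚ {p} {q} p≤q p≢q with ℚ.<-cmp p q
... | tri< p<q _ _ = p<q
... | tri≈ _ p≡q _ = ⊥-elim (p≢q p≡q)
... | tri> _ _ q<p = ⊥-elim (p≢q (ℚ.≤-antisym p≤q (ℚ.<⇒≤ q<p)))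

between-0 : ∀ p q → between p q 0ℚ ≡ p
between-0 (x₁ , y₁) (x₂ , y₂) = cong₂ _,_ (mix-0 x₁ x₂) (mix-0 y₁ y₂)

between-1 : ∀ p q → between p q 1ℚ ≡ q
between-1 (x₁ , y₁) (x₂ , y₂) = cong₂ _,_ (mix-1 x₁ x₂) (mix-1 y₁ y₂)

0≤1 : 0ℚ ℚ.≤ 1ℚ
0≤1 = ι-mono-≤ z≤n

mix-injective : ∀ {a b s t} → a ≢ b → mix s a b ≡ mix t a b → s ≡ t
mix-injective {a} {b} {s} {t} a≢b eq =
  trans (sym (rescale s)) (trans (cong (λ m → (m ℚ.- a) ℚ.* ℚ.1/ (b ℚ.- a)) eq) (rescale t))
  where
  instance
    b-a≢0 : ℚ.NonZero (b ℚ.- a)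
    b-a≢0 = ℚ.≢-nonZero (a≢b ∘ sym ∘ GroupProperties.x∙y⁻¹≈ε⇒x≈y ℚ.+-0-group b a)
  rescale : ∀ r → (mix r a b ℚ.- a) ℚ.* ℚ.1/ (b ℚ.- a) ≡ r
  rescale r = begin
    (mix r a b ℚ.- a) ℚ.* ℚ.1/ (b ℚ.- a)    ≡⟨ solve 4 (λ r a b i → ((con 1ℚ :- r) :* a :+ r :* b :- a) :* i := r :* ((b :- a) :* i)) refl r a b (ℚ.1/ (b ℚ.- a)) ⟩
    r ℚ.* ((b ℚ.- a) ℚ.* ℚ.1/ (b ℚ.- a))    ≡⟨ cong (r ℚ.*_) (ℚ.*-inverseʳ (b ℚ.- a)) ⟩
    r ℚ.* 1ℚ                                ≡⟨ ℚ.*-identityʳ r ⟩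
    r                                       ∎
    where open ≡-Reasoning

between-injective : ∀ {p q s t} → p ≢ q → between p q s ≡ between p q t → s ≡ t
between-injective {x₁ , y₁} {x₂ , y₂} p≢q eq with x₁ ℚ.≟ x₂
... | no x₁≢x₂ = mix-injective x₁≢x₂ (cong proj₁ eq)
... | yes refl = mix-injective (p≢q ∘ cong (x₁ ,_)) (cong proj₂ eq)

plot : Vec ℕ 3 → Point
plot (x ∷ y ∷ _ ∷ []) = ι x , ι y

-- The plane shows the first two barycentric coordinates, and the third is recovered as `C - X - Y`.
-- A weighting of the three coordinates thus becomes an affine function on the plane, which commutes
-- with `between`.
functional : ℕ → Vec ℕ 3 → Point → ℚ
functional C (a ∷ b ∷ c ∷ []) (X , Y) = ι a ℚ.* X ℚ.+ ι b ℚ.* Y ℚ.+ ι c ℚ.* (ι C ℚ.- X ℚ.- Y)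

functional-between : ∀ C w p q t → functional C w (between p q t) ≡ mix t (functional C w p) (functional C w q)
functional-between C (a ∷ b ∷ c ∷ []) (x₁ , y₁) (x₂ , y₂) t =
  solve 9 (λ a b c C x₁ y₁ x₂ y₂ t →
    let X = (con 1ℚ :- t) :* x₁ :+ t :* x₂
        Y = (con 1ℚ :- t) :* y₁ :+ t :* y₂
    in a :* X :+ b :* Y :+ c :* (C :- X :- Y) :=
       (con 1ℚ :- t) :* (a :* x₁ :+ b :* y₁ :+ c :* (C :- x₁ :- y₁)) :+
       t :* (a :* x₂ :+ b :* y₂ :+ c :* (C :- x₂ :- y₂)))
    refl (ι a) (ι b) (ι c) (ι C) x₁ y₁ x₂ y₂ t

functional-plot : ∀ w p → functional (Vec.sum p) w (plot p) ≡ ι (value w p)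
functional-plot (a ∷ b ∷ c ∷ []) (x ∷ y ∷ z ∷ []) = begin
  ι a ℚ.* ι x ℚ.+ ι b ℚ.* ι y ℚ.+ ι c ℚ.* (ι (x + (y + (z + 0))) ℚ.- ι x ℚ.- ι y)
    ≡⟨ cong (λ s → ι a ℚ.* ι x ℚ.+ ι b ℚ.* ι y ℚ.+ ι c ℚ.* (s ℚ.- ι x ℚ.- ι y)) ι-sum ⟩
  ι a ℚ.* ι x ℚ.+ ι b ℚ.* ι y ℚ.+ ι c ℚ.* (ι x ℚ.+ (ι y ℚ.+ ι z) ℚ.- ι x ℚ.- ι y)
    ≡⟨ solve 6 (λ a b c x y z → a :* x :+ b :* y :+ c :* (x :+ (y :+ z) :- x :- y) := a :* x :+ b :* y :+ c :* z) refl (ι a) (ι b) (ι c) (ι x) (ι y) (ι z) ⟩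
  ι a ℚ.* ι x ℚ.+ ι b ℚ.* ι y ℚ.+ ι c ℚ.* ι z
    ≡⟨ cong₂ ℚ._+_ (cong₂ ℚ._+_ (ι-* a x) (ι-* b y)) (ι-* c z) ⟨
  ι (a * x) ℚ.+ ι (b * y) ℚ.+ ι (c * z)
    ≡⟨ cong (ℚ._+ ι (c * z)) (ι-+ (a * x) (b * y)) ⟨
  ι (a * x + b * y) ℚ.+ ι (c * z)
    ≡⟨ ι-+ (a * x + b * y) (c * z) ⟨
  ι (a * x + b * y + c * z) ∎
  where
  open ≡-Reasoning
  ι-sum : ι (x + (y + (z + 0))) ≡ ι x ℚ.+ (ι y ℚ.+ ι z)
  ι-sum = trans (cong (λ k → ι (x + (y + k))) (ℕ.+-identityʳ z))
                (trans (ι-+ x (y + z)) (cong (ι x ℚ.+_) (ι-+ y z)))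

plot-injective : ∀ {p q} → Vec.sum p ≡ Vec.sum q → plot p ≡ plot q → p ≡ q
plot-injective {x ∷ y ∷ z ∷ []} {x′ ∷ y′ ∷ z′ ∷ []} eq eq′
  with ι-injective {x} {x′} (cong proj₁ eq′) | ι-injective {y} {y′} (cong proj₂ eq′)
... | refl | refl = cong (λ k → x ∷ y ∷ k ∷ []) (ℕ.+-cancelʳ-≡ 0 z z′ (ℕ.+-cancelˡ-≡ y _ _ (ℕ.+-cancelˡ-≡ x _ _ eq)))

-- Neither end of the first segment has a value above the minimum of `w` on the second, and one end
-- lies strictly below it. So every point strictly between the ends lies strictly below it too. The
-- ends themselves are exempt, which leaves room for a common vertex.
≺⇒disjoint : ∀ C w p q r s {t u} → Vec.sum p ≡ C → Vec.sum q ≡ C → Vec.sum r ≡ C → Vec.sum s ≡ C →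
             extent p q w ≺ extent r s w → 0ℚ ℚ.< t → t ℚ.< 1ℚ → InUnit u →
             between (plot p) (plot q) t ≢ between (plot r) (plot s) u
≺⇒disjoint C w p q r s {t} {u} Σp Σq Σr Σs (h≤l′ , l<l′) 0<t t<1 0≤u≤1 eq = ℚ.<⇒≢
  (ℚ.<-≤-trans
    (mix-< 0<t t<1 (ι-mono-≤ (ℕ.≤-trans (ℕ.m≤m⊔n (value w p) _) h≤l′))
                   (ι-mono-≤ (ℕ.≤-trans (ℕ.m≤n⊔m (value w p) _) h≤l′)) oneBelow)
    (≤-mix 0≤u≤1 (ι-mono-≤ (ℕ.m⊓n≤m (value w r) _)) (ι-mono-≤ (ℕ.m⊓n≤n (value w r) _))))
  (trans (sym (along p q t Σp Σq)) (trans (cong (functional C w) eq) (along r s u Σr Σs)))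
  where
  along : ∀ p q t → Vec.sum p ≡ C → Vec.sum q ≡ C →
          functional C w (between (plot p) (plot q) t) ≡ mix t (ι (value w p)) (ι (value w q))
  along p q t refl Σq = trans (functional-between C w (plot p) (plot q) t)
    (cong₂ (mix t) (functional-plot w p)
                   (subst (λ C → functional C w (plot q) ≡ ι (value w q)) Σq (functional-plot w q)))

  oneBelow : ι (value w p) ℚ.< ι (value w r ⊓ value w s) ⊎ ι (value w q) ℚ.< ι (value w r ⊓ value w s)
  oneBelow with ℕ.⊓-sel (value w p) (value w q)
  ... | inj₁ eq = inj₁ (ι-mono-< (subst (_< _) eq l<l′))
  ... | inj₂ eq = inj₂ (ι-mono-< (subst (_< _) eq l<l′))

straight : ∀ {p q} → p ≢ q → Arc
straight {p} {q} p≢q = record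
  { m         = 0
  ; corner    = λ { zero → p ; (suc _) → q }
  ; injective = λ { zero zero s t _ _ eq → cong ((+ 0 ℚ./ 1) ℚ.+_) (between-injective {s = s} {t} p≢q eq) }
  }

module StraightLine {n : ℕ} (G : Graph n) (coords : Fin n → Vec ℕ 3) (C : ℕ)
  (coords-sum : ∀ v → Vec.sum (coords v) ≡ C)
  (coords-injective : Injective _≡_ _≡_ coords)
  (neighbour : ∀ v → ∃[ w ] Graph._~_ G v w)
  (separated : ∀ (e f : Edge G) → ¬ (Edge.src e ≡ Edge.src f × Edge.tgt e ≡ Edge.tgt f) →
     ∃[ w ] extent (coords (Edge.src e)) (coords (Edge.tgt e)) w ≺ extent (coords (Edge.src f)) (coords (Edge.tgt f)) w)
  where
  open Edge
  open Graph G using (irrefl) renaming (sym to ~-sym)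

  pos : Fin n → Point
  pos = plot ∘ coords

  pos-injective : Injective _≡_ _≡_ pos
  pos-injective {u} {v} = coords-injective ∘ plot-injective (trans (coords-sum u) (sym (coords-sum v)))

  distinctEnds : (e : Edge G) → pos (src e) ≢ pos (tgt e)
  distinctEnds e eq = Fin.<⇒≢ (src<tgt e) (pos-injective eq)

  arc : Edge G → Arc
  arc e = straight (distinctEnds e)

  avoids-edge : ∀ e f → ¬ (src e ≡ src f × tgt e ≡ tgt f) → ∀ p → p inside arc e → ¬ (p on arc f)
  avoids-edge e f e≢f p ((zero , t , 0≤t≤1 , p≡) , p≢start , p≢end) (zero , u , 0≤u≤1 , p≡′) =
    let w , e≺f = separated e f e≢f in
    ≺⇒disjoint C w (coords (src e)) (coords (tgt e)) (coords (src f)) (coords (tgt f)) {t} {u}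
      (coords-sum (src e)) (coords-sum (tgt e)) (coords-sum (src f)) (coords-sum (tgt f)) e≺f
      (≤∧≢⇒<ℚ (InUnit.lower 0≤t≤1) λ { refl → p≢start (trans p≡ (between-0 (pos (src e)) (pos (tgt e)))) })
      (≤∧≢⇒<ℚ (InUnit.upper 0≤t≤1) λ { refl → p≢end (trans p≡ (between-1 (pos (src e)) (pos (tgt e)))) })
      0≤u≤1
      (trans (sym p≡) p≡′)

  edgeAt : ∀ v → ∃[ f ] ((src f ≡ v ⊎ tgt f ≡ v) × pos v on arc f)
  edgeAt v with neighbour v
  ... | w , v~w with Fin.<-cmp v w
  ...   | tri< v<w _ _ = record { src<tgt = v<w ; adj = v~w } , inj₁ refl ,
                         zero , 0ℚ , record { lower = ℚ.≤-refl ; upper = 0≤1 } , sym (between-0 (pos v) (pos w))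
  ...   | tri≈ _ v≡w _ = ⊥-elim (irrefl v≡w v~w)
  ...   | tri> _ _ w<v = record { src<tgt = w<v ; adj = ~-sym v~w } , inj₂ refl ,
                         zero , 1ℚ , record { lower = 0≤1 ; upper = ℚ.≤-refl } , sym (between-1 (pos w) (pos v))

  -- The vertex lies on an edge `f` incident with it. Being inside `e`, it is not an end of `e`, so
  -- `f` differs from `e` and the two edges would cross.
  avoids-vertex : ∀ e w → ¬ (pos w inside arc e)
  avoids-vertex e w w-inside@(_ , ≢start , ≢end) with edgeAt w
  ... | f , inj₁ refl , w-on = avoids-edge e f (λ (eq , _) → ≢start (cong pos (sym eq))) _ w-inside w-on
  ... | f , inj₂ refl , w-on = avoids-edge e f (λ (_ , eq) → ≢end (cong pos (sym eq))) _ w-inside w-on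

  planar : Planar G
  planar = record
    { pos           = pos
    ; pos-injective = pos-injective
    ; arc           = arc
    ; arc-start     = λ _ → refl
    ; arc-end       = λ _ → refl
    ; avoids-vertex = avoids-vertex
    ; avoids-edge   = avoids-edge
    }

-- Tabulated graphs

-- A Braun tree gives fast access to the table.  It need not be proved correct:
-- the graph is by definition what the lookup returns.
data Braun (A : Set) : Set where
  leaf : Braun A
  node : A → Braun A → Braun A → Braun A

-- The left subtree holds the odd positions and the right one the even positions above 0. Inserting
-- in front changes every parity, so the old root joins the right subtree and the two subtrees
-- change places.
push : ∀ {A} → A → Braun A → Braun A
push a leaf         = node a leaf leaf
push a (node b l r) = node a (push b r) l

fromList : ∀ {A} → List A → Braun A
fromList = List.foldr push leaf

lookupOr : ∀ {A} → A → Braun A → ℕ → A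
lookupOr d leaf         _       = d
lookupOr d (node a l r) zero    = a
lookupOr d (node a l r) (suc k) with k % 2
... | zero  = lookupOr d l (k / 2)
... | suc _ = lookupOr d r (k / 2)

lookup≤sum : ∀ {m} i (xs : Vec ℕ m) → lookup xs i ≤ Vec.sum xs
lookup≤sum zero    (x ∷ xs) = ℕ.m≤m+n x _
lookup≤sum (suc i) (x ∷ xs) = ℕ.≤-trans (lookup≤sum i xs) (ℕ.m≤n+m _ x)

-- The barycentric coordinates, their pairwise differences and the negatives of
-- both, made nonnegative by adding multiples of the constant sum of coordinates.
-- The differences are needed only for edges at the corners of the outer triangle.
weights : Vec (Vec ℕ 3) 12
weights =
  (1 ∷ 0 ∷ 0 ∷ []) ∷ (0 ∷ 1 ∷ 0 ∷ []) ∷ (0 ∷ 0 ∷ 1 ∷ []) ∷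
  (0 ∷ 1 ∷ 1 ∷ []) ∷ (1 ∷ 0 ∷ 1 ∷ []) ∷ (1 ∷ 1 ∷ 0 ∷ []) ∷
  (0 ∷ 1 ∷ 2 ∷ []) ∷ (1 ∷ 2 ∷ 0 ∷ []) ∷ (2 ∷ 0 ∷ 1 ∷ []) ∷
  (0 ∷ 2 ∷ 1 ∷ []) ∷ (2 ∷ 1 ∷ 0 ∷ []) ∷ (1 ∷ 0 ∷ 2 ∷ []) ∷ []

apart : ∀ {m} → Vec (ℕ × ℕ) m → Vec (ℕ × ℕ) m → Bool
apart []             []               = false
apart ((l , h) ∷ is) ((l′ , h′) ∷ js) = ((h ≤ᵇ l′) ∧ (l <ᵇ l′)) ∨ apart is js

apart-sound : ∀ {A : Set} {m} {f g : A → ℕ × ℕ} (ws : Vec A m) →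
              T (apart (Vec.map f ws) (Vec.map g ws)) → ∃[ w ] f w ≺ g w
apart-sound (w ∷ ws) p with Equivalence.to T-∨ p
... | inj₁ q = let h≤l′ , l<l′ = Equivalence.to T-∧ q in w , ℕ.≤ᵇ⇒≤ _ _ h≤l′ , ℕ.<ᵇ⇒< _ _ l<l′
... | inj₂ q = apart-sound ws q

Segment : Set
Segment = (ℕ × ℕ) × Vec (ℕ × ℕ) 12

compatible : Segment → Segment → Bool
compatible ((u , v) , is) ((w , x) , js) = ((u ≡ᵇ w) ∧ (v ≡ᵇ x)) ∨ apart is js

-- Each pair is tested in both orders, since `_≺_` keeps only the interior of its first segment away
-- from the second.
noncrossing : List Segment → Bool
noncrossing ss = all (λ s → all (compatible s) ss) ss

noncrossing-sound : ∀ {ss s s′} → T (noncrossing ss) → s ∈ₗ ss → s′ ∈ₗ ss → T (compatible s s′)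
noncrossing-sound {ss} {s} ok s∈ s′∈ = ListAll.lookup (all⁺ _ ss (ListAll.lookup (all⁺ _ ss ok) s∈)) s′∈

record Row : Set where
  constructor row
  field
    nbrs coords : Vec ℕ 3

-- The neighbours l, r and u are the parents in the three trees, except at the
-- roots, where their order is arbitrary.
vertex : (l r u x y z : ℕ) → Row
vertex l r u x y z = row (l ∷ r ∷ u ∷ []) (x ∷ y ∷ z ∷ [])

-- Finite checks on a table of vertices

module Tabulated (n C : ℕ) (roots : Vec ℕ 3) (table : Braun Row) where

  entry : ℕ → Row
  entry = lookupOr (vertex 0 0 0 0 0 0) table

  nbrs coords : ℕ → Vec ℕ 3
  nbrs   = Row.nbrs ∘ entry
  coords = Row.coords ∘ entry

  open Search nbrs

  Rising : ℕ → Fin 3 → ℕ → Set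
  Rising u i p = lookup (coords u) i < lookup (coords p) i ×
                 (∀ j → i ≢ j → lookup (coords p) j ≤ lookup (coords u) j)

  -- The first conjunct makes adjacency closed, symmetric and irreflexive, and the second makes
  -- every degree three. The last is the Schnyder condition; roots are exempt because the tree paths
  -- end there.
  Local : ℕ → Set
  Local u = All (λ v → v < n × u ∈ nbrs v × u ≢ v) (nbrs u)
          × (∀ i j → lookup (nbrs u) i ≡ lookup (nbrs u) j → i ≡ j)
          × Vec.sum (coords u) ≡ C
          × (u ∉ roots → ∀ i → Rising u i (lookup (nbrs u) i))

  local? : ∀ u → Dec (Local u)
  local? u = All.all? (λ v → (v ℕ.<? n) ×-dec (u ∈? nbrs v) ×-dec ¬? (u ℕ.≟ v)) (nbrs u)
    ×-dec Fin.all? (λ i → Fin.all? λ j → (lookup (nbrs u) i ℕ.≟ lookup (nbrs u) j) →-dec (i Fin.≟ j))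
    ×-dec (Vec.sum (coords u) ℕ.≟ C)
    ×-dec (¬? (u ∈? roots) →-dec Fin.all? λ i → rising? u i (lookup (nbrs u) i))
    where
    rising? : ∀ u i p → Dec (Rising u i p)
    rising? u i p = (lookup (coords u) i ℕ.<? lookup (coords p) i)
      ×-dec Fin.all? (λ j → ¬? (i Fin.≟ j) →-dec (lookup (coords p) j ℕ.≤? lookup (coords u) j))

  RootTriangle : Set
  RootTriangle = ∀ r → lookup roots r < n × (∀ s → r ≢ s → lookup roots s ∈ nbrs (lookup roots r))

  rootTriangle? : Dec RootTriangle
  rootTriangle? = Fin.all? λ r → (lookup roots r ℕ.<? n)
    ×-dec Fin.all? (λ s → ¬? (r Fin.≟ s) →-dec (lookup roots s ∈? nbrs (lookup roots r)))

  -- Larger neighbours only, in accordance with the orientation of `Edge`.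
  edgesAt : ℕ → List (ℕ × ℕ)
  edgesAt u = List.map (u ,_) (List.filter (u ℕ.<?_) (toList (nbrs u)))

  segment : ℕ × ℕ → Segment
  segment (u , v) = (u , v) , Vec.map (extent (coords u) (coords v)) weights

  segments : List Segment
  segments = List.map segment (List.concatMap edgesAt (List.upTo n))

  -- Degenerate segments, for which noncrossing means that coords is injective.
  points : List Segment
  points = List.map (λ u → segment (u , u)) (List.upTo n)

  everywhere : (ℕ → Bool) → Bool
  everywhere p = all p (List.upTo n)

  everywhere-sound : ∀ p → everywhere p ≡ true → ∀ {u} → u < n → T (p u)
  everywhere-sound p eq u<n = ListAll.lookup (all⁺ p _ (Equivalence.from T-≡ eq)) (∈-upTo⁺ u<n)

  -- k counts the vertices of the cycle other than its least vertex s.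
  cycleFree : ℕ → Bool
  cycleFree k = everywhere λ s → not (closes s k [] s)

  -- The graph of a table that passes the checks

  module Realisation (3<n : 3 < n) (rootTriangle : RootTriangle) (local : ∀ {u} → u < n → Local u)
    (distinct : T (noncrossing points)) (planarity : T (noncrossing segments)) where

    localAt : ∀ (u : Fin n) → Local (toℕ u)
    localAt u = local (Fin.toℕ<n u)

    graph : Graph n
    graph = record
      { _~_    = λ u v → toℕ v ∈ nbrs (toℕ u)
      ; _~?_   = λ u v → toℕ v ∈? nbrs (toℕ u)
      ; sym    = λ {u} v∈ → proj₁ (proj₂ (All.lookup (proj₁ (localAt u)) v∈))
      ; irrefl = λ { {u} refl u∈ → proj₂ (proj₂ (All.lookup (proj₁ (localAt u)) u∈)) refl }
      }

    parent<n : ∀ i (u : Fin n) → lookup (nbrs (toℕ u)) i < n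
    parent<n i u = proj₁ (All.lookup (proj₁ (localAt u)) (∈-lookup i _))

    parent : Fin 3 → Fin n → Fin n
    parent i u = fromℕ< (parent<n i u)

    toℕ-parent : ∀ i u → toℕ (parent i u) ≡ lookup (nbrs (toℕ u)) i
    toℕ-parent i u = Fin.toℕ-fromℕ< (parent<n i u)

    open Graph graph hiding (sym)

    ~-parent : ∀ i u → u ~ parent i u
    ~-parent i u = subst (_∈ nbrs (toℕ u)) (sym (toℕ-parent i u)) (∈-lookup i _)

    parent-injective : ∀ u {i j} → parent i u ≡ parent j u → i ≡ j
    parent-injective u {i} {j} eq = proj₁ (proj₂ (localAt u)) i j
      (trans (sym (toℕ-parent i u)) (trans (cong toℕ eq) (toℕ-parent j u)))

    ~⇒parent : ∀ {u v} → u ~ v → ∃[ i ] v ≡ parent i u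
    ~⇒parent {u} v∈ = index v∈ , Fin.toℕ-injective (trans (lookup-index v∈) (sym (toℕ-parent (index v∈) u)))

    -- The filtered list of neighbours and the list of the three parents have the same members and
    -- no repetitions, so each is a permutation of the other.
    cubic : Cubic graph
    cubic u = trans
      (↭-length (∼bag⇒↭ (unique∧set⇒bag
        (Unique.filter⁺ (u ~?_) (Unique.allFin⁺ n))
        (Unique.tabulate⁺ {f = λ i → parent i u} (parent-injective u))
        (mk⇔ to from))))
      (length-tabulate (λ i → parent i u))
      where
      to : ∀ {v} → v ∈ₗ List.filter (u ~?_) (List.allFin n) → v ∈ₗ List.tabulate (λ i → parent i u)
      to v∈ with ~⇒parent {u} (proj₂ (∈-filter⁻ (u ~?_) {xs = List.allFin n} v∈))
      ... | i , refl = ∈-tabulate⁺ {f = λ i → parent i u} i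
      from : ∀ {v} → v ∈ₗ List.tabulate (λ i → parent i u) → v ∈ₗ List.filter (u ~?_) (List.allFin n)
      from v∈ with ∈-tabulate⁻ {f = λ i → parent i u} v∈
      ... | i , refl = ∈-filter⁺ (u ~?_) (∈-allFin _) (~-parent i u)

    coord : Fin 3 → Fin n → ℕ
    coord i u = lookup (coords (toℕ u)) i

    root : Fin 3 → Fin n
    root r = fromℕ< (proj₁ (rootTriangle r))

    toℕ-root : ∀ r → toℕ (root r) ≡ lookup roots r
    toℕ-root r = Fin.toℕ-fromℕ< (proj₁ (rootTriangle r))

    rising : ∀ i u → (∀ r → u ≢ root r) → Rising (toℕ u) i (toℕ (parent i u))
    rising i u u≢root = subst (Rising (toℕ u) i) (sym (toℕ-parent i u))
      (proj₂ (proj₂ (proj₂ (localAt u)))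
        (λ u∈ → u≢root (index u∈) (Fin.toℕ-injective (trans (lookup-index u∈) (sym (toℕ-root (index u∈)))))) i)

    3-connected : KConnected graph 3
    3-connected = SchnyderWood.3-connected graph parent coord root C ~-parent
      (λ i u → subst (coord i u ≤_) (coords-sum u) (lookup≤sum i (coords (toℕ u))))
      (λ i u u≢root → proj₁ (rising i u u≢root))
      (λ i j u u≢root → proj₂ (rising i u u≢root) j)
      (λ r s r≢s → subst (λ v → toℕ (root s) ∈ nbrs v) (sym (toℕ-root r))
        (subst (_∈ nbrs (lookup roots r)) (sym (toℕ-root s)) (proj₂ (rootTriangle r) s r≢s)))
      3<n
      where
      coords-sum : ∀ u → Vec.sum (coords (toℕ u)) ≡ C
      coords-sum u = proj₁ (proj₂ (proj₂ (localAt u)))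

    -- Between degenerate segments `_≺_` is a strict inequality of values under one weight, which
    -- equal coordinates would contradict.
    coords-injective : Injective _≡_ _≡_ (λ (u : Fin n) → coords (toℕ u))
    coords-injective {u} {v} eq with Equivalence.to T-∨ (noncrossing-sound distinct (point∈ u) (point∈ v))
      where
      point∈ : ∀ (u : Fin n) → segment (toℕ u , toℕ u) ∈ₗ points
      point∈ u = ∈-map⁺ (λ u → segment (u , u)) (∈-upTo⁺ (Fin.toℕ<n u))
    ... | inj₁ same = Fin.toℕ-injective (ℕ.≡ᵇ⇒≡ _ _ (proj₁ (Equivalence.to T-∧ same)))
    ... | inj₂ p =
      let w , _ , l<l′ = apart-sound {f = point u} {g = point v} weights p in
      ⊥-elim (ℕ.<-irrefl (cong (λ p → proj₁ (extent p p w)) eq) l<l′)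
      where
      point : Fin n → Vec ℕ 3 → ℕ × ℕ
      point u = extent (coords (toℕ u)) (coords (toℕ u))

    segment∈ : ∀ (e : Edge graph) → segment (toℕ (Edge.src e) , toℕ (Edge.tgt e)) ∈ₗ segments
    segment∈ e = ∈-map⁺ segment (∈-concatMap⁺ edgesAt (lose (∈-upTo⁺ (Fin.toℕ<n src))
      (∈-map⁺ (toℕ src ,_) (∈-filter⁺ (toℕ src ℕ.<?_) (∈-toList⁺ adj) src<tgt))))
      where open Edge e

    planar : Planar graph
    planar = StraightLine.planar graph (coords ∘ toℕ) C
      (λ u → proj₁ (proj₂ (proj₂ (localAt u))))
      coords-injective
      (λ u → parent 0F u , ~-parent 0F u)
      separated
      where
      open Edge
      separated : ∀ e f → ¬ (src e ≡ src f × tgt e ≡ tgt f) → _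
      separated e f e≢f with Equivalence.to T-∨ (noncrossing-sound planarity (segment∈ e) (segment∈ f))
      ... | inj₁ same = let src≡ , tgt≡ = Equivalence.to T-∧ same in
        ⊥-elim (e≢f (Fin.toℕ-injective (ℕ.≡ᵇ⇒≡ _ _ src≡) , Fin.toℕ-injective (ℕ.≡ᵇ⇒≡ _ _ tgt≡)))
      ... | inj₂ p = apart-sound
        {f = extent (coords (toℕ (src e))) (coords (toℕ (tgt e)))}
        {g = extent (coords (toℕ (src f))) (coords (toℕ (tgt f)))} weights p

  -- Each check is an equation with `true`, so that `refl` settles it by evaluation once the table
  -- is supplied. The arguments 3, 7 and 15 are the cycle lengths less one.
  theorem :
    3 < n →
    ⌊ rootTriangle? ⌋ ≡ true →
    everywhere (λ u → ⌊ local? u ⌋) ≡ true →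
    noncrossing points ≡ true →
    noncrossing segments ≡ true →
    cycleFree 3 ≡ true → cycleFree 7 ≡ true → cycleFree 15 ≡ true →
    Σ[ G ∈ Graph n ] (KConnected G 3 × Cubic G × Planar G × ¬ Cycle G 4 × ¬ Cycle G 8 × ¬ Cycle G 16)
  theorem 3<n triangle local distinct noncrossing no4 no8 no16 =
    R.graph , R.3-connected , R.cubic , R.planar , without 3 no4 , without 7 no8 , without 15 no16
    where
    module R = Realisation 3<n
      (toWitness {a? = rootTriangle?} (Equivalence.from T-≡ triangle))
      (λ {u} u<n → toWitness {a? = local? u} (everywhere-sound _ local u<n))
      (Equivalence.from T-≡ distinct)
      (Equivalence.from T-≡ noncrossing)
    without : ∀ k → cycleFree k ≡ true → ¬ Cycle R.graph (suc k)
    without k free = no-cycle R.graph (λ v∈ → v∈) k (everywhere-sound _ free)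

-- The rotation group of the icosahedron acts freely on the vertices of this
-- graph; 60 i, …, 60 i + 59 form an orbit, and the orbits are ordered so as to
-- shorten the search for cycles.  There are 120 triangles, 60 pentagons, 20 faces of length 18
-- and 12 of length 20.  The coordinates of a vertex count the faces, other than the
-- outer one, in the regions into which its three tree paths divide the plane.
graph : List Row
graph =
  vertex 240 360 180 1 1 209 ∷
  vertex 361 181 241 99 67 45 ∷
  vertex 242 362 182 50 29 132 ∷
  vertex 183 243 363 200 8 3 ∷
  vertex 184 244 364 116 57 38 ∷
  vertex 185 245 365 60 36 115 ∷
  vertex 366 186 246 29 18 164 ∷
  vertex 187 247 367 11 169 31 ∷
  vertex 188 248 368 60 85 66 ∷
  vertex 369 189 249 43 18 150 ∷
  vertex 190 250 370 11 183 17 ∷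
  vertex 371 191 251 71 67 73 ∷
  vertex 372 192 252 57 32 122 ∷
  vertex 373 193 253 8 4 199 ∷
  vertex 254 374 194 92 64 55 ∷
  vertex 255 375 195 64 43 104 ∷
  vertex 256 376 196 1 208 2 ∷
  vertex 257 377 197 36 120 55 ∷
  vertex 378 198 258 134 53 24 ∷
  vertex 199 259 379 179 22 10 ∷
  vertex 380 200 260 29 137 45 ∷
  vertex 381 201 261 71 53 87 ∷
  vertex 382 202 262 43 32 136 ∷
  vertex 383 203 263 22 4 185 ∷
  vertex 264 384 204 106 64 41 ∷
  vertex 385 205 265 57 46 108 ∷
  vertex 266 386 206 190 15 6 ∷
  vertex 207 267 387 88 71 52 ∷
  vertex 388 208 268 141 46 24 ∷
  vertex 269 389 209 204 1 6 ∷
  vertex 270 390 210 50 99 62 ∷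
  vertex 211 271 391 123 57 31 ∷
  vertex 272 392 212 1 204 6 ∷
  vertex 273 393 213 36 113 62 ∷
  vertex 274 394 214 15 155 41 ∷
  vertex 215 275 395 158 36 17 ∷
  vertex 276 396 216 50 92 69 ∷
  vertex 217 277 397 32 8 171 ∷
  vertex 398 218 278 8 179 24 ∷
  vertex 279 399 219 169 29 13 ∷
  vertex 220 280 400 32 127 52 ∷
  vertex 281 401 221 127 50 34 ∷
  vertex 222 282 402 186 22 3 ∷
  vertex 223 283 403 81 71 59 ∷
  vertex 284 404 224 15 162 34 ∷
  vertex 285 405 225 1 197 13 ∷
  vertex 286 406 226 64 78 69 ∷
  vertex 407 227 287 22 144 45 ∷
  vertex 288 408 228 1 190 20 ∷
  vertex 229 289 409 74 57 80 ∷
  vertex 290 410 230 36 15 160 ∷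
  vertex 291 411 231 15 1 195 ∷
  vertex 292 412 232 64 50 97 ∷
  vertex 233 293 413 46 22 143 ∷
  vertex 234 294 414 25 148 38 ∷
  vertex 295 415 235 148 43 20 ∷
  vertex 236 296 416 46 106 59 ∷
  vertex 237 297 417 25 8 178 ∷
  vertex 238 298 418 165 36 10 ∷
  vertex 239 299 419 74 71 66 ∷
  vertex 300 256 63 209 1 1 ∷
  vertex 301 260 66 29 134 48 ∷
  vertex 302 262 69 43 29 139 ∷
  vertex 60 303 269 207 1 3 ∷
  vertex 271 67 304 120 60 31 ∷
  vertex 275 70 305 155 39 17 ∷
  vertex 280 61 306 29 130 52 ∷
  vertex 64 307 284 18 162 31 ∷
  vertex 71 308 286 67 78 66 ∷
  vertex 293 62 309 43 25 143 ∷
  vertex 65 310 295 151 43 17 ∷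
  vertex 299 68 311 71 74 66 ∷
  vertex 245 75 312 57 39 115 ∷
  vertex 247 78 313 8 172 31 ∷
  vertex 314 251 81 71 64 76 ∷
  vertex 315 265 72 57 43 111 ∷
  vertex 79 316 272 4 204 3 ∷
  vertex 82 317 273 39 113 59 ∷
  vertex 318 278 73 8 176 27 ∷
  vertex 282 76 319 183 25 3 ∷
  vertex 320 287 83 22 141 48 ∷
  vertex 289 74 321 71 60 80 ∷
  vertex 296 77 322 43 109 59 ∷
  vertex 297 80 323 22 11 178 ∷
  vertex 324 241 87 99 64 48 ∷
  vertex 248 90 325 57 88 66 ∷
  vertex 326 249 93 43 15 153 ∷
  vertex 84 327 254 95 64 52 ∷
  vertex 328 258 91 134 50 27 ∷
  vertex 329 263 94 22 1 188 ∷
  vertex 85 330 276 53 92 66 ∷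
  vertex 88 331 281 130 50 31 ∷
  vertex 95 332 285 4 197 10 ∷
  vertex 86 333 290 39 15 157 ∷
  vertex 89 334 291 18 1 192 ∷
  vertex 298 92 335 162 39 10 ∷
  vertex 99 336 242 53 29 129 ∷
  vertex 243 102 337 197 11 3 ∷
  vertex 250 105 338 8 186 17 ∷
  vertex 339 252 96 57 29 125 ∷
  vertex 103 340 257 39 120 52 ∷
  vertex 341 261 106 71 50 90 ∷
  vertex 97 342 266 193 15 3 ∷
  vertex 267 100 343 85 74 52 ∷
  vertex 107 344 274 18 155 38 ∷
  vertex 98 345 288 4 190 17 ∷
  vertex 101 346 292 67 50 94 ∷
  vertex 294 104 347 22 151 38 ∷
  vertex 111 348 240 4 1 206 ∷
  vertex 244 114 349 113 60 38 ∷
  vertex 350 246 117 29 15 167 ∷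
  vertex 351 253 108 8 1 202 ∷
  vertex 115 352 255 67 43 101 ∷
  vertex 259 118 353 176 25 10 ∷
  vertex 109 354 264 109 64 38 ∷
  vertex 355 268 112 141 43 27 ∷
  vertex 119 356 270 53 99 59 ∷
  vertex 277 110 357 29 11 171 ∷
  vertex 113 358 279 172 29 10 ∷
  vertex 283 116 359 78 74 59 ∷
  vertex 348 228 360 1 3 207 ∷
  vertex 204 361 324 101 65 45 ∷
  vertex 336 216 362 50 31 130 ∷
  vertex 363 337 217 198 8 5 ∷
  vertex 364 349 229 114 57 40 ∷
  vertex 365 312 192 58 36 117 ∷
  vertex 230 366 350 31 16 164 ∷
  vertex 367 313 193 9 169 33 ∷
  vertex 368 325 205 58 85 68 ∷
  vertex 206 369 326 45 16 150 ∷
  vertex 370 338 218 9 183 19 ∷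
  vertex 194 371 314 73 65 73 ∷
  vertex 219 372 339 59 30 122 ∷
  vertex 231 373 351 10 2 199 ∷
  vertex 327 207 374 92 66 53 ∷
  vertex 352 232 375 64 45 102 ∷
  vertex 376 300 180 0 211 0 ∷
  vertex 340 220 377 36 122 53 ∷
  vertex 208 378 328 136 51 24 ∷
  vertex 379 353 233 177 22 12 ∷
  vertex 181 380 301 31 135 45 ∷
  vertex 221 381 341 73 51 87 ∷
  vertex 182 382 302 45 30 136 ∷
  vertex 209 383 329 24 2 185 ∷
  vertex 354 234 384 106 66 39 ∷
  vertex 195 385 315 59 44 108 ∷
  vertex 342 222 386 190 17 4 ∷
  vertex 387 343 223 86 71 54 ∷
  vertex 235 388 355 143 44 24 ∷
  vertex 303 183 389 204 3 4 ∷
  vertex 356 236 390 50 101 60 ∷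
  vertex 391 304 184 121 57 33 ∷
  vertex 316 196 392 1 206 4 ∷
  vertex 317 197 393 36 115 60 ∷
  vertex 344 224 394 15 157 39 ∷
  vertex 395 305 185 156 36 19 ∷
  vertex 330 210 396 50 94 67 ∷
  vertex 397 357 237 30 8 173 ∷
  vertex 198 398 318 10 177 24 ∷
  vertex 358 238 399 169 31 11 ∷
  vertex 400 306 186 30 127 54 ∷
  vertex 331 211 401 127 52 32 ∷
  vertex 402 319 199 184 22 5 ∷
  vertex 403 359 239 79 71 61 ∷
  vertex 307 187 404 15 164 32 ∷
  vertex 332 212 405 1 199 11 ∷
  vertex 308 188 406 64 80 67 ∷
  vertex 200 407 320 24 142 45 ∷
  vertex 345 225 408 1 192 18 ∷
  vertex 409 321 201 72 57 82 ∷
  vertex 333 213 410 36 17 158 ∷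
  vertex 334 214 411 15 3 193 ∷
  vertex 346 226 412 64 52 95 ∷
  vertex 413 309 189 44 22 145 ∷
  vertex 414 347 227 23 148 40 ∷
  vertex 310 190 415 148 45 18 ∷
  vertex 416 322 202 44 106 61 ∷
  vertex 417 323 203 23 8 180 ∷
  vertex 418 335 215 163 36 12 ∷
  vertex 419 311 191 72 71 68 ∷
  vertex 300 0 136 0 0 211 ∷
  vertex 1 140 301 32 134 45 ∷
  vertex 2 142 302 46 29 136 ∷
  vertex 303 3 149 204 4 3 ∷
  vertex 151 304 4 120 57 34 ∷
  vertex 155 305 5 155 36 20 ∷
  vertex 160 306 6 29 127 55 ∷
  vertex 307 7 164 15 165 31 ∷
  vertex 308 8 166 64 81 66 ∷
  vertex 173 309 9 43 22 146 ∷
  vertex 310 10 175 148 46 17 ∷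
  vertex 179 311 11 71 71 69 ∷
  vertex 125 312 12 57 36 118 ∷
  vertex 127 313 13 8 169 34 ∷
  vertex 14 131 314 74 64 73 ∷
  vertex 15 145 315 60 43 108 ∷
  vertex 316 16 152 1 207 3 ∷
  vertex 317 17 153 36 116 59 ∷
  vertex 18 158 318 11 176 24 ∷
  vertex 162 319 19 183 22 6 ∷
  vertex 20 167 320 25 141 45 ∷
  vertex 169 321 21 71 57 83 ∷
  vertex 176 322 22 43 106 62 ∷
  vertex 177 323 23 22 8 181 ∷
  vertex 24 121 324 102 64 45 ∷
  vertex 128 325 25 57 85 69 ∷
  vertex 26 129 326 46 15 150 ∷
  vertex 327 27 134 92 67 52 ∷
  vertex 28 138 328 137 50 24 ∷
  vertex 29 143 329 25 1 185 ∷
  vertex 330 30 156 50 95 66 ∷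
  vertex 331 31 161 127 53 31 ∷
  vertex 332 32 165 1 200 10 ∷
  vertex 333 33 170 36 18 157 ∷
  vertex 334 34 171 15 4 192 ∷
  vertex 178 335 35 162 36 13 ∷
  vertex 336 36 122 50 32 129 ∷
  vertex 123 337 37 197 8 6 ∷
  vertex 130 338 38 8 183 20 ∷
  vertex 39 132 339 60 29 122 ∷
  vertex 340 40 137 36 123 52 ∷
  vertex 41 141 341 74 50 87 ∷
  vertex 342 42 146 190 18 3 ∷
  vertex 147 343 43 85 71 55 ∷
  vertex 344 44 154 15 158 38 ∷
  vertex 345 45 168 1 193 17 ∷
  vertex 346 46 172 64 53 94 ∷
  vertex 174 347 47 22 148 41 ∷
  vertex 348 48 120 1 4 206 ∷
  vertex 124 349 49 113 57 41 ∷
  vertex 50 126 350 32 15 164 ∷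
  vertex 51 133 351 11 1 199 ∷
  vertex 352 52 135 64 46 101 ∷
  vertex 139 353 53 176 22 13 ∷
  vertex 354 54 144 106 67 38 ∷
  vertex 55 148 355 144 43 24 ∷
  vertex 356 56 150 50 102 59 ∷
  vertex 157 357 57 29 8 174 ∷
  vertex 358 58 159 169 32 10 ∷
  vertex 163 359 59 78 71 62 ∷
  vertex 108 360 0 2 1 208 ∷
  vertex 361 1 84 99 66 46 ∷
  vertex 96 362 2 51 29 131 ∷
  vertex 3 97 363 199 9 3 ∷
  vertex 4 109 364 115 58 38 ∷
  vertex 5 72 365 59 37 115 ∷
  vertex 366 6 110 29 17 165 ∷
  vertex 7 73 367 10 170 31 ∷
  vertex 8 85 368 59 86 66 ∷
  vertex 369 9 86 43 17 151 ∷
  vertex 10 98 370 10 184 17 ∷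
  vertex 371 11 74 71 66 74 ∷
  vertex 372 12 99 57 31 123 ∷
  vertex 373 13 111 8 3 200 ∷
  vertex 87 374 14 93 64 54 ∷
  vertex 112 375 15 65 43 103 ∷
  vertex 60 376 16 2 208 1 ∷
  vertex 100 377 17 37 120 54 ∷
  vertex 378 18 88 134 52 25 ∷
  vertex 19 113 379 178 23 10 ∷
  vertex 380 20 61 29 136 46 ∷
  vertex 381 21 101 71 52 88 ∷
  vertex 382 22 62 43 31 137 ∷
  vertex 383 23 89 22 3 186 ∷
  vertex 114 384 24 107 64 40 ∷
  vertex 385 25 75 57 45 109 ∷
  vertex 102 386 26 191 15 5 ∷
  vertex 27 103 387 87 72 52 ∷
  vertex 388 28 115 141 45 25 ∷
  vertex 63 389 29 205 1 5 ∷
  vertex 116 390 30 51 99 61 ∷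
  vertex 31 64 391 122 58 31 ∷
  vertex 76 392 32 2 204 5 ∷
  vertex 77 393 33 37 113 61 ∷
  vertex 104 394 34 16 155 40 ∷
  vertex 35 65 395 157 37 17 ∷
  vertex 90 396 36 51 92 68 ∷
  vertex 37 117 397 31 9 171 ∷
  vertex 398 38 78 8 178 25 ∷
  vertex 118 399 39 170 29 12 ∷
  vertex 40 66 400 31 128 52 ∷
  vertex 91 401 41 128 50 33 ∷
  vertex 42 79 402 185 23 3 ∷
  vertex 43 119 403 80 72 59 ∷
  vertex 67 404 44 16 162 33 ∷
  vertex 92 405 45 2 197 12 ∷
  vertex 68 406 46 65 78 68 ∷
  vertex 407 47 80 22 143 46 ∷
  vertex 105 408 48 2 190 19 ∷
  vertex 49 81 409 73 58 80 ∷
  vertex 93 410 50 37 15 159 ∷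
  vertex 94 411 51 16 1 194 ∷
  vertex 106 412 52 65 50 96 ∷
  vertex 53 69 413 45 23 143 ∷
  vertex 54 107 414 24 149 38 ∷
  vertex 70 415 55 149 43 19 ∷
  vertex 56 82 416 45 107 59 ∷
  vertex 57 83 417 24 9 178 ∷
  vertex 58 95 418 164 37 10 ∷
  vertex 59 71 419 73 72 66 ∷
  vertex 60 180 136 211 0 0 ∷
  vertex 181 140 61 31 134 46 ∷
  vertex 182 142 62 45 29 137 ∷
  vertex 63 183 149 205 3 3 ∷
  vertex 151 64 184 120 58 33 ∷
  vertex 155 65 185 155 37 19 ∷
  vertex 160 66 186 29 128 54 ∷
  vertex 67 187 164 16 164 31 ∷
  vertex 68 188 166 65 80 66 ∷
  vertex 173 69 189 43 23 145 ∷
  vertex 70 190 175 149 45 17 ∷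
  vertex 179 71 191 71 72 68 ∷
  vertex 125 72 192 57 37 117 ∷
  vertex 127 73 193 8 170 33 ∷
  vertex 194 131 74 73 64 74 ∷
  vertex 195 145 75 59 43 109 ∷
  vertex 76 196 152 2 206 3 ∷
  vertex 77 197 153 37 115 59 ∷
  vertex 198 158 78 10 176 25 ∷
  vertex 162 79 199 183 23 5 ∷
  vertex 200 167 80 24 141 46 ∷
  vertex 169 81 201 71 58 82 ∷
  vertex 176 82 202 43 107 61 ∷
  vertex 177 83 203 22 9 180 ∷
  vertex 204 121 84 101 64 46 ∷
  vertex 128 85 205 57 86 68 ∷
  vertex 206 129 86 45 15 151 ∷
  vertex 87 207 134 93 66 52 ∷
  vertex 208 138 88 136 50 25 ∷
  vertex 209 143 89 24 1 186 ∷
  vertex 90 210 156 51 94 66 ∷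
  vertex 91 211 161 128 52 31 ∷
  vertex 92 212 165 2 199 10 ∷
  vertex 93 213 170 37 17 157 ∷
  vertex 94 214 171 16 3 192 ∷
  vertex 178 95 215 162 37 12 ∷
  vertex 96 216 122 51 31 129 ∷
  vertex 123 97 217 197 9 5 ∷
  vertex 130 98 218 8 184 19 ∷
  vertex 219 132 99 59 29 123 ∷
  vertex 100 220 137 37 122 52 ∷
  vertex 221 141 101 73 50 88 ∷
  vertex 102 222 146 191 17 3 ∷
  vertex 147 103 223 85 72 54 ∷
  vertex 104 224 154 16 157 38 ∷
  vertex 105 225 168 2 192 17 ∷
  vertex 106 226 172 65 52 94 ∷
  vertex 174 107 227 22 149 40 ∷
  vertex 108 228 120 2 3 206 ∷
  vertex 124 109 229 113 58 40 ∷
  vertex 230 126 110 31 15 165 ∷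
  vertex 231 133 111 10 1 200 ∷
  vertex 112 232 135 65 45 101 ∷
  vertex 139 113 233 176 23 12 ∷
  vertex 114 234 144 107 66 38 ∷
  vertex 235 148 115 143 43 25 ∷
  vertex 116 236 150 51 101 59 ∷
  vertex 157 117 237 29 9 173 ∷
  vertex 118 238 159 170 31 10 ∷
  vertex 163 119 239 78 72 61 ∷
  vertex 240 120 0 1 2 208 ∷
  vertex 121 1 241 100 66 45 ∷
  vertex 242 122 2 50 30 131 ∷
  vertex 3 243 123 199 8 4 ∷
  vertex 4 244 124 115 57 39 ∷
  vertex 5 245 125 59 36 116 ∷
  vertex 126 6 246 30 17 164 ∷
  vertex 7 247 127 10 169 32 ∷
  vertex 8 248 128 59 85 67 ∷
  vertex 129 9 249 44 17 150 ∷
  vertex 10 250 130 10 183 18 ∷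
  vertex 131 11 251 72 66 73 ∷
  vertex 132 12 252 58 31 122 ∷
  vertex 133 13 253 9 3 199 ∷
  vertex 254 134 14 92 65 54 ∷
  vertex 255 135 15 64 44 103 ∷
  vertex 256 136 16 1 209 1 ∷
  vertex 257 137 17 36 121 54 ∷
  vertex 138 18 258 135 52 24 ∷
  vertex 19 259 139 178 22 11 ∷
  vertex 140 20 260 30 136 45 ∷
  vertex 141 21 261 72 52 87 ∷
  vertex 142 22 262 44 31 136 ∷
  vertex 143 23 263 23 3 185 ∷
  vertex 264 144 24 106 65 40 ∷
  vertex 145 25 265 58 45 108 ∷
  vertex 266 146 26 190 16 5 ∷
  vertex 27 267 147 87 71 53 ∷
  vertex 148 28 268 142 45 24 ∷
  vertex 269 149 29 204 2 5 ∷
  vertex 270 150 30 50 100 61 ∷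
  vertex 31 271 151 122 57 32 ∷
  vertex 272 152 32 1 205 5 ∷
  vertex 273 153 33 36 114 61 ∷
  vertex 274 154 34 15 156 40 ∷
  vertex 35 275 155 157 36 18 ∷
  vertex 276 156 36 50 93 68 ∷
  vertex 37 277 157 31 8 172 ∷
  vertex 158 38 278 9 178 24 ∷
  vertex 279 159 39 169 30 12 ∷
  vertex 40 280 160 31 127 53 ∷
  vertex 281 161 41 127 51 33 ∷
  vertex 42 282 162 185 22 4 ∷
  vertex 43 283 163 80 71 60 ∷
  vertex 284 164 44 15 163 33 ∷
  vertex 285 165 45 1 198 12 ∷
  vertex 286 166 46 64 79 68 ∷
  vertex 167 47 287 23 143 45 ∷
  vertex 288 168 48 1 191 19 ∷
  vertex 49 289 169 73 57 81 ∷
  vertex 290 170 50 36 16 159 ∷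
  vertex 291 171 51 15 2 194 ∷
  vertex 292 172 52 64 51 96 ∷
  vertex 53 293 173 45 22 144 ∷
  vertex 54 294 174 24 148 39 ∷
  vertex 295 175 55 148 44 19 ∷
  vertex 56 296 176 45 106 60 ∷
  vertex 57 297 177 24 8 179 ∷
  vertex 58 298 178 164 36 11 ∷
  vertex 59 299 179 73 71 67 ∷
  []

mainTheorem1 : Σ[ G ∈ Graph 420 ]
    (KConnected G 3 × Cubic G × Planar G × ¬ Cycle G 4 × ¬ Cycle G 8 × ¬ Cycle G 16)
-- There are 630 edges, hence 212 faces by Euler's formula and 211 besides the outer one. The roots
-- are the corners of the outer triangle, with coordinates (211, 0, 0), (0, 211, 0) and (0, 0, 211)
-- in this order.
mainTheorem1 = Tabulated.theorem 420 211 (300 ∷ 136 ∷ 180 ∷ []) (fromList graph)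
  (ℕ.m≤m+n 4 416) refl refl refl refl refl refl refl
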